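{- Let $N \in \mathbb{N}$ and suppose that $A$ is an arithmetic progression of length $N$ in $\mathbb{Z}$. Then $A$ is not $N$-stable (in $\mathbb{Z}$).
   Context: $\mathbb{N}=\{1,2,3,\dots\}$. An arithmetic progression of length $N$ in $\mathbb{Z}$ is a set of the form $\{x,x+d,\dots,x+(N-1)d\}$ with $x,d \in \mathbb{Z}$ and $d \neq 0$ (so it has exactly $N$ elements). Let $G$ be an Abelian group, $A \subset G$ and $k \in \mathbb{N}$. The set $A$ has the $k$-order property (in $G$) if there are vectors $s=(s_1,\dots,s_k)$ and $t=(t_1,\dots,t_k)$ in $G^k$ such that for all $1 \leq i,j \leq k$ one has $s_i+t_j \in A$ if and only if $i \leq j$. The set $A$ is $k$-stable (in $G$) if it does not have the $k$-order property. -}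

module Defs where

open import Algebra.Bundles using (AbelianGroup)
open import Data.Fin.Base using (Fin; toℕ; _≤_)
open import Data.Integer.Base using (ℤ; 0ℤ; +_; _+_; _*_)
open import Data.Nat.Base using (ℕ)
open import Data.Product.Base using (_×_; ∃₂; ∃-syntax)
open import Data.Vec.Functional using (Vector)
open import Function.Bundles using (_⇔_)
open import Level using (Level; 0ℓ; _⊔_)
open import Relation.Binary.PropositionalEquality.Core using (_≡_; _≢_)
open import Relation.Nullary.Negation.Core using (¬_)
open import Relation.Unary using (Pred; _≐_)

private
  variable
    ℓ : Level

progression : ℤ → ℤ → ℕ → Pred ℤ 0ℓ
progression x d N z = ∃[ i ] z ≡ x + + (toℕ {N} i) * d

IsArithmeticProgression : ℕ → Pred ℤ ℓ → Set ℓ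
IsArithmeticProgression N A = ∃[ x ] ∃[ d ] d ≢ 0ℤ × A ≐ progression x d N

-- A subset of G is a predicate on the carrier; when _≈_ is not
-- propositional equality it should be taken to respect _≈_.
module _ {c e : Level} (G : AbelianGroup c e) where
  open AbelianGroup G using (Carrier; _∙_)

  -- Indices run over 0, …, k - 1 in place of 1, …, k. The case k = 0,
  -- where the property holds vacuously, lies outside the usual definition.
  HasOrderProperty : ℕ → Pred Carrier ℓ → Set (c ⊔ ℓ)
  HasOrderProperty k A =
    ∃₂ λ (s t : Vector Carrier k) →
      (i j : Fin k) → A (s i ∙ t j) ⇔ i ≤ j

  IsStable : ℕ → Pred Carrier ℓ → Set (c ⊔ ℓ)
  IsStable k A = ¬ HasOrderProperty k A

{-# OPTIONS --safe #-}

-- If A = {x + k d : 0 ≤ k < N}, take s_i = x - i d and t_j = j d. Then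
-- s_i + t_j = x + (j - i) d with j - i < N, so it lies in A exactly when
-- j - i ≥ 0.
module Submission where

open import Defs
open import Data.Fin.Base using (Fin; toℕ; fromℕ<; _≤_)
open import Data.Fin.Properties using (toℕ<n; toℕ-fromℕ<)
open import Data.Integer.Base using (ℤ; 0ℤ; +_; _+_; _-_; _*_; ≢-nonZero)
open import Data.Integer.Properties
  using (+-0-abelianGroup; +-injective; *-cancelʳ-≡)
open import Data.Integer.Tactic.RingSolver using (solve-∀)
open import Data.Nat.Base as ℕ using (ℕ; NonZero)
import Data.Nat.Properties as ℕ
open import Data.Product.Base using (_,_)
open import Algebra.Properties.AbelianGroup +-0-abelianGroup using (∙-cancelˡ)
open import Function.Bundles using (_⇔_; mk⇔; module Equivalence)
open import Level using (Level)
open import Relation.Binary.PropositionalEquality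
  using (_≡_; _≢_; sym; trans; cong; subst)
open import Relation.Nullary.Negation.Core using (¬_)
open import Relation.Unary using (Pred)

-- As `d` is nonzero and ℤ has no zero divisors, a point `x + m * d` determines `m`. Hence
-- `x + (j - i) * d` lies in the progression only if `j - i` is one of `0, …, N - 1`. The upper
-- bound is automatic from `j < N`, so only `i ≤ j` remains.

shift-identity : ∀ x d i k → (x - i * d) + (k + i) * d ≡ x + k * d
shift-identity = solve-∀

-- Cancel `x - i * d`, then the nonzero factor `d`. Writing the result as a sum in ℕ makes `i ≤ j`
-- immediate.
shift⇒sum : ∀ {x d i j k} → d ≢ 0ℤ →
  (x - + i * d) + + j * d ≡ x + + k * d → j ≡ k ℕ.+ i
shift⇒sum {x} {d} {i} {j} {k} d≢0 eq =
  +-injective (*-cancelʳ-≡ (+ j) (+ (k ℕ.+ i)) d {{≢-nonZero d≢0}}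
    (∙-cancelˡ (x - + i * d) _ _
      -- `+ k + + i` computes to `+ (k ℕ.+ i)`.
      (trans eq (sym (shift-identity x d (+ i) (+ k))))))

progression⇔≤ : ∀ {x d N} → d ≢ 0ℤ → (i j : Fin N) →
  progression x d N ((x - + toℕ i * d) + + toℕ j * d) ⇔ i ≤ j
progression⇔≤ {x} {d} {N} d≢0 i j = mk⇔ to from
  where
  sum = (x - + toℕ i * d) + + toℕ j * d

  to : progression x d N sum → i ≤ j
  to (k , eq) = subst (toℕ i ℕ.≤_)
    (sym (shift⇒sum {x} {d} {toℕ i} {toℕ j} {toℕ k} d≢0 eq))
    (ℕ.m≤n+m (toℕ i) (toℕ k))

  from : i ≤ j → progression x d N sum
  -- The point has index `j ∸ i`; the truncated subtraction is exact because `i ≤ j`.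
  from i≤j = fromℕ< j∸i<N , trans
    (cong (λ m → (x - + toℕ i * d) + + m * d) (sym (ℕ.m∸n+n≡m i≤j)))
    (trans (shift-identity x d (+ toℕ i) (+ (toℕ j ℕ.∸ toℕ i)))
      (cong (λ m → x + + m * d) (sym (toℕ-fromℕ< j∸i<N))))
    where
    j∸i<N : toℕ j ℕ.∸ toℕ i ℕ.< N
    j∸i<N = ℕ.≤-<-trans (ℕ.m∸n≤m (toℕ j) (toℕ i)) (toℕ<n j)

proposition1p2 : {ℓ : Level} (N : ℕ) .{{_ : NonZero N}} (A : Pred ℤ ℓ) →
    IsArithmeticProgression N A → ¬ IsStable +-0-abelianGroup N A
proposition1p2 N A (x , d , d≢0 , A⊆P , P⊆A) stable = stable
  ( (λ i → x - + toℕ i * d)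
  , (λ j → + toℕ j * d)
  , λ i j → let open Equivalence (progression⇔≤ {x} d≢0 i j) in
      mk⇔ (λ a → to (A⊆P a)) (λ i≤j → P⊆A (from i≤j))
  )
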